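{- $\mathsf{QC2_=}$ is not the logic of any class of selection frames; that is, there is no class $\mathcal{C}$ of selection frames such that the set of theorems of $\mathsf{QC2_=}$ equals the set of $\mathcal{L}_=$-formulas valid in every frame of $\mathcal{C}$.
   Context: The language $\mathcal{L}_=$: countably many variables, for each $n$ countably many $n$-place predicates, and a binary identity predicate $=$; formulas $\phi ::= P^n(x_1,\dots,x_n)\mid x=y\mid\neg\phi\mid(\phi\supset\phi)\mid(\phi>\phi)\mid\forall x\phi$; $\wedge,\vee,\equiv,\top,\bot,\exists$ defined as usual; $\Box\phi:=(\neg\phi>\bot)$, $\Diamond\phi:=\neg(\phi>\bot)$; $\phi[y/x]$ is capture-avoiding substitution. $\mathsf{QC2_=}$ is the set of formulas derivable from: (A1) substitution instances of propositional tautologies; (A2) $\phi>\phi$; (A3) $((\phi>\psi)\wedge(\psi>\phi)\wedge(\phi>\chi))\supset(\psi>\chi)$; (A4) $(\phi>\psi)\supset(\phi\supset\psi)$; (A5) $(\phi>\psi)\vee(\phi>\neg\psi)$; (A6) $\forall x\phi\supset\phi[y/x]$; (A7) $\forall x(\phi>\psi)\supset(\phi>\forall x\psi)$ where $x$ is not free in $\phi$; (I1) $x=x$; (I2) $x=y\supset(\phi\equiv\phi[y/x])$; (I3) $x\neq y\supset\Box x\neq y$; rules (R1) from $\phi$ and $\phi\supset\psi$ infer $\psi$; (R2) from $(\psi_1\wedge\cdots\wedge\psi_n)\supset\chi$ infer $((\phi>\psi_1)\wedge\cdots\wedge(\phi>\psi_n))\supset(\phi>\chi)$; (R3) from $\psi\supset\phi[y/x]$,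 where $y$ is not free in $\psi$ or $\forall x\phi$, infer $\psi\supset\forall x\phi$. A selection frame is $\langle W,R,f,D,d\rangle$ with $W\neq\varnothing$, $R\subseteq W\times W$, $f:\mathcal{P}(W)\times W\to\mathcal{P}(W)$ with $f(P,w)\subseteq R(w):=\{v: wRv\}$, $D\neq\varnothing$, $d:W\to\mathcal{P}(D)$ (possibly empty local domains). A model adds $I$ with $I(P^n,w)\subseteq D^n$ for non-logical predicates. With assignments $g$ from variables to $D$: atomic clauses via $I$; $w,g\Vdash x=y$ iff $g(x)=g(y)$; $\neg,\supset$ classical; $w,g\Vdash\forall x\phi$ iff $w,g^x_a\Vdash\phi$ for all $a\in d(w)$; $w,g\Vdash\phi>\psi$ iff $f([\phi]^g,w)\subseteq[\psi]^g$, $[\phi]^g=\{v: v,g\Vdash\phi\}$. Validity in a frame: truth at all worlds, all assignments, all models on the frame; in a class: in every frame of it. -}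

module Defs where

open import Level using (Level; 0ℓ) renaming (suc to lsuc)
open import Data.Nat using (ℕ; zero; suc; _⊔_; _≡ᵇ_)
open import Data.Bool.ListAction using (any)
open import Data.Bool using (Bool; true; false; if_then_else_; _∧_; _∨_; not)
open import Data.List using (List; []; _∷_; _++_; map; filterᵇ; foldr)
open import Data.Vec using (Vec)
import Data.Vec as Vec
open import Data.Product using (Σ; _×_; _,_)
open import Data.Empty using (⊥)
open import Relation.Binary.PropositionalEquality using (_≡_)
open import Function.Bundles using (_⇔_)

-- Syntax of L_=
-- Variables are natural numbers.  The k-th n-place predicate is
-- indexed by (n , k).

data Fm : Set where
  atom : (n k : ℕ) → Vec ℕ n → Fm
  _≐_  : ℕ → ℕ → Fm
  ¬'_  : Fm → Fm
  _⊃_  : Fm → Fm → Fm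
  _>_  : Fm → Fm → Fm
  ∀'   : ℕ → Fm → Fm

infix  9 _≐_
infix  8 ¬'_
infixr 6 _⊃_
infixr 6 _>_

_∧'_ : Fm → Fm → Fm
φ ∧' ψ = ¬' (φ ⊃ ¬' ψ)

_∨'_ : Fm → Fm → Fm
φ ∨' ψ = (¬' φ) ⊃ ψ

_≡'_ : Fm → Fm → Fm
φ ≡' ψ = (φ ⊃ ψ) ∧' (ψ ⊃ φ)

⊤' : Fm
⊤' = atom 0 0 Vec.[] ⊃ atom 0 0 Vec.[]

⊥' : Fm
⊥' = ¬' ⊤'

∃' : ℕ → Fm → Fm
∃' x φ = ¬' (∀' x (¬' φ))

□ : Fm → Fm
□ φ = (¬' φ) > ⊥'

◇ : Fm → Fm
◇ φ = ¬' (φ > ⊥')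

fv : Fm → List ℕ
fv (atom n k xs) = Vec.toList xs
fv (x ≐ y)       = x ∷ y ∷ []
fv (¬' φ)        = fv φ
fv (φ ⊃ ψ)       = fv φ ++ fv ψ
fv (φ > ψ)       = fv φ ++ fv ψ
fv (∀' x φ)      = filterᵇ (λ u → not (u ≡ᵇ x)) (fv φ)

vars : Fm → List ℕ
vars (atom n k xs) = Vec.toList xs
vars (x ≐ y)       = x ∷ y ∷ []
vars (¬' φ)        = vars φ
vars (φ ⊃ ψ)       = vars φ ++ vars ψ
vars (φ > ψ)       = vars φ ++ vars ψ
vars (∀' x φ)      = x ∷ vars φ

freeIn : ℕ → Fm → Bool
freeIn x φ = any (λ u → u ≡ᵇ x) (fv φ)

NotFree : ℕ → Fm → Set
NotFree x φ = freeIn x φ ≡ false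

maxL : List ℕ → ℕ
maxL = foldr _⊔_ 0

-- Capture-avoiding simultaneous substitution of variables for variables.
-- At a binder ∀z, the bound variable is renamed to a fresh one exactly
-- when some free variable u of ∀zφ is sent to z by σ (capture).

update : (ℕ → ℕ) → ℕ → ℕ → (ℕ → ℕ)
update σ z z' u = if u ≡ᵇ z then z' else σ u

sub : (ℕ → ℕ) → Fm → Fm
sub σ (atom n k xs) = atom n k (Vec.map σ xs)
sub σ (x ≐ y)       = σ x ≐ σ y
sub σ (¬' φ)        = ¬' (sub σ φ)
sub σ (φ ⊃ ψ)       = sub σ φ ⊃ sub σ ψ
sub σ (φ > ψ)       = sub σ φ > sub σ ψ
sub σ (∀' z φ)      =
  let clash = any (λ u → σ u ≡ᵇ z) (fv (∀' z φ))
      fresh = suc (maxL (z ∷ vars φ ++ map σ (fv φ)))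
      z'    = if clash then fresh else z
  in ∀' z' (sub (update σ z z') φ)

_[_/_] : Fm → ℕ → ℕ → Fm
φ [ y / x ] = sub (λ u → if u ≡ᵇ x then y else u) φ

data PF : Set where
  pv   : ℕ → PF
  pneg : PF → PF
  pimp : PF → PF → PF

evalB : (ℕ → Bool) → PF → Bool
evalB v (pv i)     = v i
evalB v (pneg p)   = not (evalB v p)
evalB v (pimp p q) = not (evalB v p) ∨ evalB v q

Tautology : PF → Set
Tautology p = (v : ℕ → Bool) → evalB v p ≡ true

inst : (ℕ → Fm) → PF → Fm
inst s (pv i)     = s i
inst s (pneg p)   = ¬' inst s p
inst s (pimp p q) = inst s p ⊃ inst s q

⋀ : Fm → List Fm → Fm
⋀ ψ []        = ψ
⋀ ψ (ψ' ∷ ψs) = ψ ∧' ⋀ ψ' ψs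

data Thm : Fm → Set where
  A1 : ∀ p (s : ℕ → Fm) → Tautology p → Thm (inst s p)
  A2 : ∀ φ → Thm (φ > φ)
  A3 : ∀ φ ψ χ → Thm (((φ > ψ) ∧' ((ψ > φ) ∧' (φ > χ))) ⊃ (ψ > χ))
  A4 : ∀ φ ψ → Thm ((φ > ψ) ⊃ (φ ⊃ ψ))
  A5 : ∀ φ ψ → Thm ((φ > ψ) ∨' (φ > ¬' ψ))
  A6 : ∀ x y φ → Thm (∀' x φ ⊃ (φ [ y / x ]))
  A7 : ∀ x φ ψ → NotFree x φ → Thm (∀' x (φ > ψ) ⊃ (φ > ∀' x ψ))
  I1 : ∀ x → Thm (x ≐ x)
  I2 : ∀ x y φ → Thm ((x ≐ y) ⊃ (φ ≡' (φ [ y / x ])))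
  I3 : ∀ x y → Thm ((¬' (x ≐ y)) ⊃ □ (¬' (x ≐ y)))
  R1 : ∀ φ ψ → Thm φ → Thm (φ ⊃ ψ) → Thm ψ
  R2 : ∀ φ ψ ψs χ → Thm (⋀ ψ ψs ⊃ χ)
       → Thm (⋀ (φ > ψ) (map (φ >_) ψs) ⊃ (φ > χ))
  R3 : ∀ ψ φ x y → NotFree y ψ → NotFree y (∀' x φ)
       → Thm (ψ ⊃ (φ [ y / x ])) → Thm (ψ ⊃ ∀' x φ)

-- Selection frames.  Subsets of W are predicates W → Set; since such
-- predicates are intensional, f is required to respect extensional
-- equivalence of subsets (as it does for genuine subsets).

record Frame : Set₁ where
  field
    W    : Set
    w₀   : W                                  -- W ≠ ∅
    R    : W → W → Set
    f    : (W → Set) → W → (W → Set)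
    f⊆R  : ∀ P w v → f P w v → R w v
    f-ext : ∀ (P Q : W → Set) → (∀ v → P v ⇔ Q v)
            → ∀ w v → f P w v ⇔ f Q w v
    D    : Set
    a₀   : D                                  -- D ≠ ∅
    d    : W → D → Set                        -- d(w) ⊆ D, possibly empty

Interp : Frame → Set₁
Interp F = (n k : ℕ) → W → Vec D n → Set
  where open Frame F

module _ (F : Frame) (I : Interp F) where
  open Frame F

  _[_↦_] : (ℕ → D) → ℕ → D → (ℕ → D)
  (g [ x ↦ a ]) u = if u ≡ᵇ x then a else g u

  Sat : W → (ℕ → D) → Fm → Set
  Sat w g (atom n k xs) = I n k w (Vec.map g xs)
  Sat w g (x ≐ y)       = g x ≡ g y
  Sat w g (¬' φ)        = Sat w g φ → ⊥
  Sat w g (φ ⊃ ψ)       = Sat w g φ → Sat w g ψ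
  Sat w g (φ > ψ)       = ∀ v → f (λ u → Sat u g φ) w v → Sat v g ψ
  Sat w g (∀' x φ)      = ∀ a → d w a → Sat w (g [ x ↦ a ]) φ

Valid : Frame → Fm → Set₁
Valid F φ = (I : Interp F) (w : Frame.W F) (g : ℕ → Frame.D F) → Sat F I w g φ

ValidIn : (Frame → Set₁) → Fm → Set₁
ValidIn C φ = ∀ F → C F → Valid F φ

{-# OPTIONS --safe #-}

-- On a frame validating (A2), (A3) and (A5), the selection function at w picks
-- the least element of a well-order, for arbitrary sets of worlds.  So if X
-- denotes at w a nonempty set of individuals, then among the individuals in X
-- there is one whose nearest Q-world is nearest of all: apply f to the set of
-- worlds where some individual that is X *at w* is Q.  As X need not be rigid,
-- no formula expresses that set, and the corresponding principle
-- `nearestWitness` is not derivable.  It fails at the base world of a model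
-- with individuals ℤ and worlds ℤ plus a base world, where Q holds at world a
-- of a alone, the base world orders the worlds as
--     base ≺ 0 ≺ 1 ≺ 2 ≺ … ≺ -3 ≺ -2 ≺ -1,
-- all other worlds see only themselves, and X is true at the base world of the
-- negative integers.  By permutation invariance every formula defines a finite
-- or cofinite set of worlds, and such sets have a ≺-least element if nonempty,
-- so the model satisfies every theorem of QC2=.
module Submission where

open import Defs
open import Level using (Level; 0ℓ)
open import Axiom.ExcludedMiddle using (ExcludedMiddle)
open import Data.Bool using (Bool; true; false; if_then_else_; not; T)
open import Data.Bool.ListAction using (any)
open import Data.Bool.Properties using (T?)
open import Data.Empty using (⊥)
open import Data.Integer using (ℤ; +_; -[1+_]; ∣_∣)
import Data.Integer as ℤ
open import Data.List using ([]; _∷_; _++_; map)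
open import Data.List.Membership.Propositional using (_∈_)
open import Data.List.Membership.Propositional.Properties using (∈-++⁺ˡ; ∈-++⁺ʳ; ∈-filter⁺; ∈-filter⁻; ∈-map⁺)
open import Data.List.Relation.Unary.Any using (here; there)
open import Data.Maybe using (Maybe; just; nothing)
open import Data.Nat using (ℕ; zero; suc; _≤_; _<_; z≤n; s≤s; _≡ᵇ_; _≟_)
open import Data.Nat.Properties using (≤-antisym; ≤-refl; ≤-trans; <-irrefl; n≤1+n; m≤m⊔n; m≤n⊔m; m≤n⇒m<n∨m≡n; ≤-pred; ≰⇒>; _≤?_)
open import Data.Product using (Σ; ∃; _×_; _,_; proj₁; proj₂)
open import Data.Sum using (inj₁; inj₂)
open import Data.Unit using (⊤; tt)
open import Data.Vec using (Vec; []; _∷_; toList)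
import Data.Vec as Vec
open import Data.Vec.Properties using (map-∘)
open import Function using (_∘_; id)
open import Function.Bundles using (_⇔_; mk⇔; Equivalence)
open import Relation.Binary.PropositionalEquality using (_≡_; _≢_; refl; sym; trans; cong; cong₂; subst)
open import Relation.Nullary using (¬_; Dec; yes; no; does; proof; contradiction; Reflects; invert; ¬-reflects; _→-reflects_)
open import Relation.Nullary.Decidable using (dec-true; dec-false; decidable-stable)

open Equivalence using (to; from)

-- Free variables and the renaming of bound ones.

module _ {a} {A : Set a} {x y : A} where

  if-≡ : ∀ {m n} → m ≡ n → (if m ≡ᵇ n then x else y) ≡ x
  if-≡ {m} {n} m≡n = cong (if_then x else y) (dec-true (m ≟ n) m≡n)

  if-≢ : ∀ {m n} → m ≢ n → (if m ≡ᵇ n then x else y) ≡ y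
  if-≢ {m} {n} m≢n = cong (if_then x else y) (dec-false (m ≟ n) m≢n)

any-false⁻ : ∀ (p : ℕ → Bool) {us u} → any p us ≡ false → u ∈ us → p u ≡ false
any-false⁻ p {v ∷ us} none (here refl) with p v
... | false = refl
any-false⁻ p {v ∷ us} none (there u∈us) with p v
... | false = any-false⁻ p none u∈us

none-≡ : ∀ (σ : ℕ → ℕ) {us u z} → any (λ v → σ v ≡ᵇ z) us ≡ false → u ∈ us → σ u ≢ z
none-≡ σ {u = u} {z} none u∈us σu≡z
  with () ← trans (sym (dec-true (σ u ≟ z) σu≡z)) (any-false⁻ (λ v → σ v ≡ᵇ z) none u∈us)

∈⇒≤maxL : ∀ {us u} → u ∈ us → u ≤ maxL us
∈⇒≤maxL {v ∷ us} (here refl)  = m≤m⊔n v (maxL us)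
∈⇒≤maxL {v ∷ us} (there u∈us) = ≤-trans (∈⇒≤maxL u∈us) (m≤n⊔m v (maxL us))

fv-∀⁺ : ∀ {u} x φ → u ∈ fv φ → u ≢ x → u ∈ fv (∀' x φ)
fv-∀⁺ {u} x φ u∈ u≢x =
  ∈-filter⁺ (λ v → T? (not (v ≡ᵇ x))) u∈ (subst (T ∘ not) (sym (dec-false (u ≟ x) u≢x)) tt)

fv-∀⁻ : ∀ {u} x φ → u ∈ fv (∀' x φ) → u ∈ fv φ
fv-∀⁻ x φ = proj₁ ∘ ∈-filter⁻ (λ u → T? (not (u ≡ᵇ x)))

-- Repeats the choice of bound variable in `sub` literally, so that `sub σ (∀' z φ)` unfolds to a
-- formula binding `binder σ z φ`.
binder : (ℕ → ℕ) → ℕ → Fm → ℕ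
binder σ z φ =
  if any (λ u → σ u ≡ᵇ z) (fv (∀' z φ))
  then suc (maxL (z ∷ vars φ ++ map σ (fv φ)))
  else z

binder-avoids : ∀ σ z φ {u} → u ∈ fv (∀' z φ) → σ u ≢ binder σ z φ
binder-avoids σ z φ {u} u∈ σu≡ with any (λ v → σ v ≡ᵇ z) (fv (∀' z φ)) in clash
... | false = none-≡ σ clash u∈ σu≡
... | true  = <-irrefl σu≡ (s≤s (∈⇒≤maxL (there (∈-++⁺ʳ (vars φ) (∈-map⁺ σ (fv-∀⁻ z φ u∈))))))

map-cong-∈ : ∀ {A B : Set} {n} {g h : A → B} (xs : Vec A n) →
             (∀ {u} → u ∈ toList xs → g u ≡ h u) → Vec.map g xs ≡ Vec.map h xs
map-cong-∈ []       g≗h = refl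
map-cong-∈ (x ∷ xs) g≗h = cong₂ _∷_ (g≗h (here refl)) (map-cong-∈ xs (g≗h ∘ there))

-- Coincidence and substitution in an arbitrary model.

module Semantics (F : Frame) (I : Interp F) where
  open Frame F

  infix 4 _∙_⊩_

  _∙_⊩_ : W → (ℕ → D) → Fm → Set
  w ∙ g ⊩ φ = Sat F I w g φ

  override : (ℕ → D) → ℕ → D → ℕ → D
  override = _[_↦_] F I

  AgreeOn : Fm → (g h : ℕ → D) → Set
  AgreeOn φ g h = ∀ {u} → u ∈ fv φ → g u ≡ h u

  agree-∀ : ∀ x φ a {g h} → AgreeOn (∀' x φ) g h → AgreeOn φ (override g x a) (override h x a)
  agree-∀ x φ a g≗h {u} u∈ with u ≟ x
  ... | yes u≡x = trans (if-≡ u≡x) (sym (if-≡ u≡x))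
  ... | no  u≢x = trans (if-≢ u≢x) (trans (g≗h (fv-∀⁺ x φ u∈ u≢x)) (sym (if-≢ u≢x)))

  coincidence : ∀ φ {w g h} → AgreeOn φ g h → w ∙ g ⊩ φ → w ∙ h ⊩ φ
  coincidence (atom n k xs) {w} g≗h = subst (I n k w) (map-cong-∈ xs g≗h)
  coincidence (x ≐ y) g≗h gx≡gy =
    trans (sym (g≗h (here refl))) (trans gx≡gy (g≗h (there (here refl))))
  coincidence (¬' φ) g≗h ¬s s = ¬s (coincidence φ (sym ∘ g≗h) s)
  coincidence (φ ⊃ ψ) g≗h s t =
    coincidence ψ (g≗h ∘ ∈-++⁺ʳ (fv φ)) (s (coincidence φ (sym ∘ g≗h ∘ ∈-++⁺ˡ) t))
  coincidence (φ > ψ) {w} g≗h s v fv =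
    coincidence ψ (g≗h ∘ ∈-++⁺ʳ _) (s v (to (f-ext _ _ same w v) fv))
    where same = λ _ → mk⇔ (coincidence φ (sym ∘ g≗h ∘ ∈-++⁺ˡ)) (coincidence φ (g≗h ∘ ∈-++⁺ˡ))
  coincidence (∀' x φ) g≗h s a a∈ = coincidence φ (agree-∀ x φ a g≗h) (s a a∈)

  agree-sub : ∀ σ z φ a {g h} → AgreeOn (∀' z φ) h (g ∘ σ) →
              let z' = binder σ z φ in
              AgreeOn φ (override h z a) (override g z' a ∘ update σ z z')
  agree-sub σ z φ a {g} {h} h≗gσ {u} u∈ with u ≟ z
  ... | yes u≡z = trans (if-≡ u≡z) (sym (trans (cong (override g _ a) (if-≡ u≡z)) (if-≡ {m = binder σ z φ} refl)))
  ... | no  u≢z = trans (if-≢ u≢z) (trans (h≗gσ u∈∀)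
      (sym (trans (cong (override g _ a) (if-≢ u≢z)) (if-≢ (binder-avoids σ z φ u∈∀)))))
    where u∈∀ = fv-∀⁺ z φ u∈ u≢z

  -- Agreement on free variables is all that survives a quantifier, since `binder` avoids only the
  -- images of free variables. The antecedent of a conditional is handled by `f-ext`.
  substitution : ∀ σ φ {w g h} → AgreeOn φ h (g ∘ σ) → w ∙ g ⊩ sub σ φ ⇔ w ∙ h ⊩ φ
  substitution σ (atom n k xs) {w} {g} {h} h≗gσ =
    mk⇔ (subst (I n k w) same) (subst (I n k w) (sym same))
    where
    same = trans (sym (map-∘ g σ xs)) (sym (map-cong-∈ xs h≗gσ))
  substitution σ (x ≐ y) h≗gσ =
    mk⇔ (λ e → trans hx (trans e (sym hy))) (λ e → trans (sym hx) (trans e hy))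
    where
    hx = h≗gσ (here refl)
    hy = h≗gσ (there (here refl))
  substitution σ (¬' φ) h≗gσ = mk⇔ (_∘ from ih) (_∘ to ih)
    where ih = substitution σ φ h≗gσ
  substitution σ (φ ⊃ ψ) h≗gσ =
    mk⇔ (λ s → to ihψ ∘ s ∘ from ihφ) (λ s → from ihψ ∘ s ∘ to ihφ)
    where
    ihφ = substitution σ φ (h≗gσ ∘ ∈-++⁺ˡ)
    ihψ = substitution σ ψ (h≗gσ ∘ ∈-++⁺ʳ (fv φ))
  substitution σ (φ > ψ) {w} {g} {h} h≗gσ =
    mk⇔ (λ s v → to ihψ ∘ s v ∘ from (same v)) (λ s v → from ihψ ∘ s v ∘ to (same v))
    where
    ihψ : ∀ {v} → v ∙ g ⊩ sub σ ψ ⇔ v ∙ h ⊩ ψ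
    ihψ = substitution σ ψ (h≗gσ ∘ ∈-++⁺ʳ (fv φ))
    same = f-ext _ _ (λ v → substitution σ φ {v} (h≗gσ ∘ ∈-++⁺ˡ)) w
  substitution σ (∀' z φ) {w} {g} {h} h≗gσ =
    mk⇔ (λ s a a∈ → to (ih a) (s a a∈)) (λ s a a∈ → from (ih a) (s a a∈))
    where
    ih = λ a → substitution (update σ z (binder σ z φ)) φ (agree-sub σ z φ a {g} {h} h≗gσ)

  agree-fresh : ∀ φ y a g → NotFree y φ → AgreeOn φ g (override g y a)
  agree-fresh φ y a g y∉ u∈ = sym (if-≢ (none-≡ id y∉ u∈))

  ∀-elim : ∀ x y φ {w g} → d w (g y) → w ∙ g ⊩ ∀' x φ → w ∙ g ⊩ φ [ y / x ]
  ∀-elim x y φ {w} {g} y∈ s = from (substitution _ φ agree) (s (g y) y∈)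
    where
    agree : AgreeOn φ (override g x (g y)) (λ u → g (if u ≡ᵇ x then y else u))
    agree {u} _ with u ≡ᵇ x
    ... | true  = refl
    ... | false = refl

  replacement : ∀ x y φ {w g} → g x ≡ g y → w ∙ g ⊩ φ [ y / x ] ⇔ w ∙ g ⊩ φ
  replacement x y φ {w} {g} gx≡gy = substitution _ φ agree
    where
    agree : AgreeOn φ g (λ u → g (if u ≡ᵇ x then y else u))
    agree {u} _ with u ≟ x
    ... | yes refl = trans gx≡gy (cong g (sym (if-≡ {m = u} refl)))
    ... | no u≢x   = cong g (sym (if-≢ u≢x))

  -- The premise is used at the assignment sending `y` to the arbitrary individual `a`, which
  -- affects neither `ψ` nor `∀' x φ`.
  ∀-intro : ∀ ψ φ x y → NotFree y ψ → NotFree y (∀' x φ) →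
            ∀ {w} → (∀ g → w ∙ g ⊩ (ψ ⊃ φ [ y / x ])) → ∀ g → w ∙ g ⊩ (ψ ⊃ ∀' x φ)
  ∀-intro ψ φ x y y∉ψ y∉φ ih g s a _ =
    to (substitution _ φ agree) (ih (override g y a) (coincidence ψ (agree-fresh ψ y a g y∉ψ) s))
    where
    agree : AgreeOn φ (override g x a) (λ u → override g y a (if u ≡ᵇ x then y else u))
    agree {u} u∈ with u ≟ x
    ... | yes u≡x = trans (if-≡ u≡x) (sym (trans (cong (override g y a) (if-≡ u≡x)) (if-≡ {m = y} refl)))
    ... | no  u≢x = trans (if-≢ u≢x) (trans
      (agree-fresh (∀' x φ) y a g y∉φ (fv-∀⁺ x φ u∈ u≢x))
      (cong (override g y a) (sym (if-≢ u≢x))))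

  -- Propositional reasoning under excluded middle.

  module Classical (em : ExcludedMiddle 0ℓ) where

    stable : ∀ {A : Set} → ¬ ¬ A → A
    stable = decidable-stable em

    ∧-elim : ∀ {A B : Set} → ¬ (A → ¬ B) → A × B
    ∧-elim c = stable λ ¬ab → c λ a b → ¬ab (a , b)

    -- Deciding the substituted formulas at `w` gives a Boolean valuation, whose values reflect
    -- truth at `w`.
    taut-sound : ∀ p s → Tautology p → ∀ {w g} → w ∙ g ⊩ inst s p
    taut-sound p s taut {w} {g} = invert (subst (Reflects _) (taut val) (reflects p))
      where
      val : ℕ → Bool
      val i = does (em {w ∙ g ⊩ s i})
      reflects : ∀ q → Reflects (w ∙ g ⊩ inst s q) (evalB val q)
      reflects (pv i)     = proof em
      reflects (pneg q)   = ¬-reflects (reflects q)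
      reflects (pimp q r) = reflects q →-reflects reflects r

    >-⋀ : ∀ φ ψ ψs {w g v} → w ∙ g ⊩ ⋀ (φ > ψ) (map (φ >_) ψs) →
          f (λ u → u ∙ g ⊩ φ) w v → v ∙ g ⊩ ⋀ ψ ψs
    >-⋀ φ ψ []        s fv = s _ fv
    >-⋀ φ ψ (ψ' ∷ ψs) s fv c =
      let s₁ , s₂ = ∧-elim s in c (s₁ _ fv) (>-⋀ φ ψ' ψs s₂ fv)

-- The principle valid on frames but not derivable

Q X : ℕ → Fm
Q x = atom 1 0 (x ∷ [])
X x = atom 1 1 (x ∷ [])

-- The conditional compares two individuals at a time, so the set of worlds where some X is Q need
-- not be expressed.
nearestWitness : Fm
nearestWitness = ∃' 0 (X 0) ⊃ ∃' 0 (X 0 ∧' ∀' 1 (X 1 ⊃ ((Q 0 ∨' Q 1) > Q 0)))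

module _ (em : ExcludedMiddle 0ℓ) (F : Frame)
         (a2 : ∀ φ → Valid F (φ > φ))
         (a3 : ∀ φ ψ χ → Valid F (((φ > ψ) ∧' ((ψ > φ) ∧' (φ > χ))) ⊃ (ψ > χ)))
         (a5 : ∀ φ ψ → Valid F ((φ > ψ) ∨' (φ > ¬' ψ)))
         where
  open Frame F

  nearestWitness-valid : Valid F nearestWitness
  nearestWitness-valid I w g ∃X none = ∃X λ a a∈ Xa → pick a a∈ Xa em
    where
    Witness : W → Set
    Witness v = Σ D λ a → d w a × I 1 1 w (a ∷ []) × I 1 0 v (a ∷ [])

    -- I with the 0-place predicate 0, which nearestWitness does not mention,
    -- reinterpreted.
    I′ : Interp F
    I′ zero    zero    v [] = Witness v
    I′ zero    (suc k) = I zero (suc k)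
    I′ (suc n) k       = I (suc n) k

    -- Under `I′` the truth set of `p` is `Witness` by definition, so axioms instantiated at `p`
    -- speak of `f Witness`.
    p : Fm
    p = atom 0 0 []

    -- If `a` is Q throughout `f Witness w`, it beats every rival `b`: `p` and `Q∨Q` conditionally
    -- imply each other, so (A3) carries `Q 0` from `p` over to `Q∨Q`.
    nearest : ∀ a → d w a → I 1 1 w (a ∷ []) → (∀ v → f Witness w v → I 1 0 v (a ∷ [])) → ⊥
    nearest a a∈ Xa hits = none a a∈ λ k → k Xa λ b b∈ Xb →
      let g′ = λ u → if u ≡ᵇ 1 then b else (if u ≡ᵇ 0 then a else g u)
          Q∨Q = Q 0 ∨' Q 1
          Q∨Q⇒p : ∀ v → Sat F I′ v g′ Q∨Q → Witness v
          Q∨Q⇒p v qq = case-em (λ qa → a , a∈ , Xa , qa) (λ ¬qa → b , b∈ , Xb , qq ¬qa)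
      in a3 p Q∨Q (Q 0) I′ w g′ λ k′ → k′
           (λ v fv ¬qa → contradiction (hits v fv) ¬qa)
           λ k″ → k″ (λ v fv → Q∨Q⇒p v (a2 Q∨Q I′ w g′ v fv)) hits
      where
      case-em : ∀ {A B : Set} → (A → B) → (¬ A → B) → B
      case-em {A} y n with em {A}
      ... | yes a = y a
      ... | no ¬a = n ¬a

    -- If nothing is selected, the given `a` qualifies vacuously. Otherwise (A2) yields an
    -- individual that is Q at one selected world, and (A5) extends this to all of them.
    pick : ∀ a → d w a → I 1 1 w (a ∷ []) → Dec (∃ (f Witness w)) → ⊥
    pick a a∈ Xa (no empty) = nearest a a∈ Xa λ v fv → contradiction (v , fv) empty
    pick _ _ _ (yes (u , fu)) with a2 p I′ w g u fu
    ... | a , a∈ , Xa , qa = nearest a a∈ Xa (decidable-stable em λ ¬hits →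
            a5 p (Q 0) I′ w (λ u → if u ≡ᵇ 0 then a else g u) ¬hits u fu qa)

-- The countermodel

infix 4 _≼_

data _≼_ : Maybe ℤ → Maybe ℤ → Set where
  base       : ∀ {v} → nothing ≼ v
  ascending  : ∀ {m n} → m ≤ n → just (+ m) ≼ just (+ n)
  pos≼neg    : ∀ {m n} → just (+ m) ≼ just -[1+ n ]
  descending : ∀ {m n} → n ≤ m → just -[1+ m ] ≼ just -[1+ n ]

≼-antisym : ∀ {u v} → u ≼ v → v ≼ u → u ≡ v
≼-antisym base           base           = refl
≼-antisym (ascending p)  (ascending q)  = cong (just ∘ +_) (≤-antisym p q)
≼-antisym (descending p) (descending q) = cong (just ∘ -[1+_]) (≤-antisym q p)

Least : (Maybe ℤ → Set) → Maybe ℤ → Set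
Least P v = P v × (∀ u → P u → v ≼ u)

-- At the base world this can be empty for a nonempty `P`, such as the set of negative worlds;
-- `limit` excludes this for definable sets.
select : (Maybe ℤ → Set) → Maybe ℤ → Maybe ℤ → Set
select P nothing  v = Least P v
select P (just a) v = v ≡ just a × P v

select-cong : ∀ P Q → (∀ v → P v ⇔ Q v) → ∀ w v → select P w v → select Q w v
select-cong P Q P⇔Q nothing  v (p , least) = to (P⇔Q v) p , λ u q → least u (from (P⇔Q u) q)
select-cong P Q P⇔Q (just a) v (e , p)     = e , to (P⇔Q v) p

select-unique : ∀ {P} w {u v} → select P w u → select P w v → u ≡ v
select-unique nothing  (p , least) (q , least′) = ≼-antisym (least _ q) (least′ _ p)
select-unique (just a) (refl , _) (refl , _) = refl

select-⊆ : ∀ {P} w {v} → select P w v → P v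
select-⊆ nothing  = proj₁
select-⊆ (just a) = proj₂

select-centred : ∀ {P : Maybe ℤ → Set} w → P w → select P w w
select-centred nothing  p = p , λ _ _ → base
select-centred (just a) p = refl , p

𝔽 : Frame
𝔽 = record
  { W     = Maybe ℤ
  ; w₀    = nothing
  ; R     = λ _ _ → ⊤
  ; f     = select
  ; f⊆R   = λ _ _ _ _ → tt
  ; f-ext = λ P Q P⇔Q w v → mk⇔ (select-cong P Q P⇔Q w v)
                                 (select-cong Q P (λ u → mk⇔ (from (P⇔Q u)) (to (P⇔Q u))) w v)
  ; D     = ℤ
  ; a₀    = + 0
  ; d     = λ _ _ → ⊤
  }

data 𝕀 : Interp 𝔽 where
  Q-self : ∀ {a} → 𝕀 1 0 (just a) (a ∷ [])
  X-neg  : ∀ {m} → 𝕀 1 1 nothing (-[1+ m ] ∷ [])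

open Semantics 𝔽 𝕀

-- Invariance of truth under involutions of the individuals.

module _ (π : ℤ → ℤ) (π-involutive : ∀ a → π (π a) ≡ a) where

  Related : Fm → (g h : ℕ → ℤ) → Set
  Related φ g h = ∀ {u} → u ∈ fv φ → h u ≡ π (g u)

  flip : ∀ {a b} → b ≡ π a → a ≡ π b
  flip b≡πa = sym (trans (cong π b≡πa) (π-involutive _))

  𝕀-invariant : ∀ {n k a} (as : Vec ℤ n) → 𝕀 n k (just a) as → 𝕀 n k (just (π a)) (Vec.map π as)
  𝕀-invariant _ Q-self = Q-self

  related-∀ : ∀ x φ {a b g h} → b ≡ π a → Related (∀' x φ) g h → Related φ (override g x a) (override h x b)
  related-∀ x φ b≡πa g~h {u} u∈ with u ≟ x
  ... | yes u≡x = trans (if-≡ u≡x) (trans b≡πa (cong π (sym (if-≡ u≡x))))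
  ... | no  u≢x = trans (if-≢ u≢x) (trans (g~h (fv-∀⁺ x φ u∈ u≢x)) (cong π (sym (if-≢ u≢x))))

  -- The base world is left out: X and the order there are not invariant. Conditionals cause no
  -- trouble, as the other worlds select at most themselves. An involution makes the relation
  -- symmetric, which the contravariant cases use.
  invariance : ∀ φ {a b g h} → b ≡ π a → Related φ g h → just a ∙ g ⊩ φ → just b ∙ h ⊩ φ
  invariance (atom n k xs) {g = g} refl g~h s =
    subst (𝕀 n k _) (sym (trans (map-cong-∈ xs g~h) (map-∘ π g xs))) (𝕀-invariant _ s)
  invariance (x ≐ y) b≡πa g~h gx≡gy =
    trans (g~h (here refl)) (trans (cong π gx≡gy) (sym (g~h (there (here refl)))))
  invariance (¬' φ) b≡πa g~h ¬s s = ¬s (invariance φ (flip b≡πa) (flip ∘ g~h) s)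
  invariance (φ ⊃ ψ) b≡πa g~h s t =
    invariance ψ b≡πa (g~h ∘ ∈-++⁺ʳ (fv φ)) (s (invariance φ (flip b≡πa) (flip ∘ g~h ∘ ∈-++⁺ˡ) t))
  invariance (φ > ψ) b≡πa g~h s _ (refl , t) =
    invariance ψ b≡πa (g~h ∘ ∈-++⁺ʳ (fv φ)) (s _ (refl , invariance φ (flip b≡πa) (flip ∘ g~h ∘ ∈-++⁺ˡ) t))
  invariance (∀' x φ) b≡πa g~h s b _ =
    invariance φ b≡πa (related-∀ x φ (sym (π-involutive b)) g~h) (s (π b) tt)

swap : ℤ → ℤ → ℤ → ℤ
swap a b c with c ℤ.≟ a | c ℤ.≟ b
... | yes _ | _     = b
... | no _  | yes _ = a
... | no _  | no _  = c

swap-left : ∀ a b → swap a b a ≡ b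
swap-left a b with a ℤ.≟ a | a ℤ.≟ b
... | yes _   | _ = refl
... | no a≢a | _ = contradiction refl a≢a

swap-right : ∀ a b → swap a b b ≡ a
swap-right a b with b ℤ.≟ a | b ℤ.≟ b
... | yes b≡a | _       = b≡a
... | no _    | yes _   = refl
... | no _    | no b≢b = contradiction refl b≢b

swap-fixed : ∀ {a b c} → c ≢ a → c ≢ b → swap a b c ≡ c
swap-fixed {a} {b} {c} c≢a c≢b with c ℤ.≟ a | c ℤ.≟ b
... | yes c≡a | _       = contradiction c≡a c≢a
... | no _    | yes c≡b = contradiction c≡b c≢b
... | no _    | no _    = refl

swap-involutive : ∀ a b c → swap a b (swap a b c) ≡ c
swap-involutive a b c with c ℤ.≟ a | c ℤ.≟ b
... | yes refl | _        = swap-right a b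
... | no _     | yes refl = swap-left a b
... | no c≢a   | no c≢b   = swap-fixed c≢a c≢b

-- Swapping `a` and `b` exchanges the two worlds and fixes every parameter.
generic : ∀ φ {g a b} → (∀ {u} → u ∈ fv φ → g u ≢ a × g u ≢ b) → just a ∙ g ⊩ φ → just b ∙ g ⊩ φ
generic φ {a = a} {b} avoids =
  invariance (swap a b) (swap-involutive a b) φ (sym (swap-left a b))
    (λ u∈ → let ≢a , ≢b = avoids u∈ in sym (swap-fixed ≢a ≢b))

-- Least worlds of definable sets, soundness, and the refutation.

module _ (em : ExcludedMiddle 0ℓ) where
  open Classical em

  least-ℕ : (P : ℕ → Set) → ∀ n → P n → ∃ λ m → P m × (∀ k → P k → m ≤ k)
  least-ℕ P zero    p = 0 , p , λ _ _ → z≤n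
  least-ℕ P (suc n) p with em {P 0}
  ... | yes p₀ = 0 , p₀ , λ _ _ → z≤n
  ... | no ¬p₀ =
    let m , pm , least = least-ℕ (P ∘ suc) n p
    in suc m , pm , λ { zero p₀ → contradiction p₀ ¬p₀ ; (suc k) pk → s≤s (least k pk) }

  greatest-ℕ : (P : ℕ → Set) → ∀ N → (∀ k → P k → k < N) → ∃ P → ∃ λ m → P m × (∀ k → P k → k ≤ m)
  greatest-ℕ P zero    bound (n , p) with () ← bound n p
  greatest-ℕ P (suc N) bound ∃P with em {P N}
  ... | yes pN = N , pN , λ k pk → ≤-pred (bound k pk)
  ... | no ¬pN = greatest-ℕ P N bound′ ∃P
    where
    bound′ : ∀ k → P k → k < N
    bound′ k pk with m≤n⇒m<n∨m≡n (≤-pred (bound k pk))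
    ... | inj₁ k<N  = k<N
    ... | inj₂ refl = contradiction pk ¬pN

  -- The only danger is a truth set of negative worlds without a lower bound in ℤ. Such a set would
  -- contain worlds beyond all parameters, hence by `generic` a positive one.
  limit : ∀ φ {g v} → v ∙ g ⊩ φ → ∃ (Least (λ u → u ∙ g ⊩ φ))
  limit φ {g} {v} s with em {nothing ∙ g ⊩ φ} | em {∃ λ n → just (+ n) ∙ g ⊩ φ}
  ... | yes s₀ | _ = nothing , s₀ , λ _ _ → base
  ... | no ¬s₀ | yes (n , sₙ) =
    let m , sₘ , least = least-ℕ (λ k → just (+ k) ∙ g ⊩ φ) n sₙ
    in just (+ m) , sₘ , λ where
      nothing         t → contradiction t ¬s₀
      (just (+ k))    t → ascending (least k t)
      (just -[1+ k ]) t → pos≼neg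
  ... | no ¬s₀ | no ¬pos =
    let m , sₘ , greatest = greatest-ℕ (λ k → just -[1+ k ] ∙ g ⊩ φ) N bound (negative v s)
    in just -[1+ m ] , sₘ , λ where
      nothing         t → contradiction t ¬s₀
      (just (+ k))    t → contradiction (k , t) ¬pos
      (just -[1+ k ]) t → descending (greatest k t)
    where
    -- Exceeds every parameter in absolute value, so the world `+ N` is not a parameter either.
    N : ℕ
    N = suc (maxL (map (∣_∣ ∘ g) (fv φ)))

    small : ∀ {u} → u ∈ fv φ → ∣ g u ∣ < N
    small u∈ = s≤s (∈⇒≤maxL (∈-map⁺ (∣_∣ ∘ g) u∈))

    large : ∀ {u a} → u ∈ fv φ → N ≤ ∣ a ∣ → g u ≢ a
    large u∈ N≤a refl = <-irrefl refl (≤-trans (small u∈) N≤a)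

    -- A negative world beyond all parameters is indistinguishable from +N.
    bound : ∀ k → just -[1+ k ] ∙ g ⊩ φ → k < N
    bound k t with N ≤? k
    ... | no N≰k  = ≰⇒> N≰k
    ... | yes N≤k = contradiction
      (N , generic φ (λ u∈ → large u∈ (≤-trans N≤k (n≤1+n k)) , large u∈ ≤-refl) t) ¬pos

    negative : ∀ u → u ∙ g ⊩ φ → ∃ λ k → just -[1+ k ] ∙ g ⊩ φ
    negative nothing         t = contradiction t ¬s₀
    negative (just (+ k))    t = contradiction (k , t) ¬pos
    negative (just -[1+ k ]) t = k , t

  -- At the base world, the least `ψ`-world satisfies `φ`, so `limit` provides a least `φ`-world;
  -- each precedes the other, so they coincide.
  exchange : ∀ φ ψ χ w {g} → w ∙ g ⊩ (φ > ψ) → w ∙ g ⊩ (ψ > φ) → w ∙ g ⊩ (φ > χ) → w ∙ g ⊩ (ψ > χ)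
  exchange φ ψ χ (just a) φ>ψ ψ>φ φ>χ v (e , sψ) = φ>χ v (e , ψ>φ v (e , sψ))
  exchange φ ψ χ nothing {g} φ>ψ ψ>φ φ>χ v (sψ , least) with limit φ (ψ>φ v (sψ , least))
  ... | u , sφ , leastφ =
    subst (λ v → v ∙ g ⊩ χ)
      (≼-antisym (leastφ v (ψ>φ v (sψ , least))) (least u (φ>ψ u (sφ , leastφ))))
      (φ>χ u (sφ , leastφ))

  sound : ∀ {φ} → Thm φ → ∀ w g → w ∙ g ⊩ φ
  sound (A1 p s taut) w g = taut-sound p s taut
  sound (A2 φ) w g v = select-⊆ w
  sound (A3 φ ψ χ) w g c =
    let φ>ψ , c′ = ∧-elim c
        ψ>φ , φ>χ = ∧-elim c′
    in exchange φ ψ χ w φ>ψ ψ>φ φ>χ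
  sound (A4 φ ψ) w g φ>ψ s = φ>ψ w (select-centred w s)
  sound (A5 φ ψ) w g ¬φ>ψ v fv s = ¬φ>ψ λ u fu → subst (λ u → u ∙ g ⊩ ψ) (select-unique w fv fu) s
  sound (A6 x y φ) w g = ∀-elim x y φ tt
  sound (A7 x φ ψ x∉) w g s v fv a _ =
    s a tt v (select-cong _ _ (λ _ → mk⇔ (coincidence φ fresh) (coincidence φ (sym ∘ fresh))) w v fv)
    where fresh = λ {u} → agree-fresh φ x a g x∉ {u}
  sound (I1 x) w g = refl
  sound (I2 x y φ) w g gx≡gy c = c (from r) (to r)
    where r = replacement x y φ gx≡gy
  -- Identity does not vary with the world, so no selected world can satisfy the antecedent of the
  -- box.
  sound (I3 x y) w g x≢y v fv = contradiction x≢y (select-⊆ w fv)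
  sound (R1 φ ψ t t′) w g = sound t′ w g (sound t w g)
  sound (R2 φ ψ ψs χ t) w g s v fv = sound t v g (>-⋀ φ ψ ψs s fv)
  sound (R3 ψ φ x y y∉ψ y∉φ t) w = ∀-intro ψ φ x y y∉ψ y∉φ (sound t w)

  -- Any X individual `-[1+ m ]` is beaten by its predecessor `-[1+ suc m ]`, whose world comes
  -- earlier in the order and is not one where `-[1+ m ]` is Q.
  nearestWitness-refuted : ¬ (nothing ∙ (λ _ → + 0) ⊩ nearestWitness)
  nearestWitness-refuted s = s (λ none → none -[1+ 0 ] tt X-neg) refute
    where
    least : ∀ m u → (¬ 𝕀 1 0 u (-[1+ m ] ∷ []) → 𝕀 1 0 u (-[1+ suc m ] ∷ [])) → just -[1+ suc m ] ≼ u
    least m u qq with em {𝕀 1 0 u (-[1+ m ] ∷ [])}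
    ... | yes Q-self = descending (n≤1+n m)
    ... | no ¬q with Q-self ← qq ¬q = descending ≤-refl

    refute : ∀ a → ⊤ → ¬ (nothing ∙ override (λ _ → + 0) 0 a ⊩ (X 0 ∧' ∀' 1 (X 1 ⊃ ((Q 0 ∨' Q 1) > Q 0))))
    refute a _ c with ∧-elim c
    ... | X-neg {m} , near
      with () ← near -[1+ suc m ] tt X-neg (just -[1+ suc m ]) ((λ _ → Q-self) , least m)

theorem5p1 : (∀ {ℓ : Level} → ExcludedMiddle ℓ)
    → ¬ (Σ (Frame → Set₁) (λ C → ∀ (φ : Fm) → Thm φ ⇔ ValidIn C φ))
theorem5p1 em (C , complete) = nearestWitness-refuted em (sound em derivable nothing (λ _ → + 0))
  where
  derivable : Thm nearestWitness
  -- Being theorems, (A2), (A3) and (A5) are valid on every frame of the class, which makes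
  -- `nearestWitness` valid there and hence a theorem.
  derivable = from (complete nearestWitness) λ F F∈C →
    nearestWitness-valid em F
      (λ φ → to (complete _) (A2 φ) F F∈C)
      (λ φ ψ χ → to (complete _) (A3 φ ψ χ) F F∈C)
      (λ φ ψ → to (complete _) (A5 φ ψ) F F∈C)
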